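{- Let $k\ge 1$ and let $G$ be a graph with $\delta(G)\ge k$. Let $S$ be a minimal $k$TDS of $G$ with $|S|=\Gamma_{\times k,t}(G)$, and for each $v\in S$ choose a vertex $v'\in\mathrm{opn}_k(v;S)$ and set $S_v=N_G(v')\cap S$ (a $k$-subset of $S$ containing $v$). Let $L=\bigcap_{v\in S}S_v$ and $\ell=|L|$. If $\ell<k$, then \[ \Gamma_{\times k,t}(G)\le\Gamma_{\times (k-\ell),t}(G)+\ell. \]
   Context: A set $S\subseteq V(G)$ is a $k$-tuple total dominating set ($k$TDS) of a graph $G$ with $\delta(G)\ge k$ if $|N_G(x)\cap S|\ge k$ for every $x\in V(G)$. The upper $k$-tuple total domination number $\Gamma_{\times k,t}(G)$ is the maximum cardinality of a minimal (with respect to inclusion) $k$TDS of $G$. For $v\in S$, a vertex $v'$ is a $k$-open private neighbor of $v$ with respect to $S$ if $v\in N_G(v')$ and $|N_G(v')\cap S|=k$; $\mathrm{opn}_k(v;S)$ is the set of such $v'$ (nonempty for every $v\in S$ when $S$ is a minimal $k$TDS). -}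

module Defs where

open import Data.Fin using (Fin)
open import Data.Fin.Properties using (all?)
open import Data.Fin.Subset using (Subset; inside; outside; _∈_; _⊂_; _∩_; ⋂; ∣_∣)
open import Data.Fin.Subset.Properties using (_∈?_; _⊂?_; anySubset?)
open import Data.List using (List; []; _∷_; _++_; map; filter; allFin)
open import Data.List.Extrema.Nat using (max)
open import Data.Nat using (ℕ; zero; suc; _⊓_; _≤_; _≤?_)
open import Data.Product using (_×_; _,_; proj₁; proj₂)
import Data.Vec as Vec
open import Level using (0ℓ)
open import Relation.Binary using (Rel; Decidable; Symmetric)
open import Relation.Binary.PropositionalEquality using (_≡_)
open import Relation.Nullary using (¬_; Dec; does; ¬?; _×-dec_)
open import Relation.Nullary.Decidable using (map′)
open import Relation.Unary using (Pred)

-- Finite simple graphs; decidability of adjacency is automatic classically.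
record Graph (n : ℕ) : Set₁ where
  field
    Adj    : Rel (Fin n) 0ℓ
    adj?   : Decidable Adj
    sym    : Symmetric Adj
    irrefl : ∀ {x} → ¬ Adj x x

N : ∀ {n} → Graph n → Fin n → Subset n
N G x = Vec.tabulate λ y → does (Graph.adj? G x y)

deg : ∀ {n} → Graph n → Fin n → ℕ
deg G x = ∣ N G x ∣

-- The minimum degree, defined for graphs with at least one vertex.
δ : ∀ {m} → Graph (suc m) → ℕ
δ G = Vec.foldr₁ _⊓_ (Vec.tabulate (deg G))

IsTDS : ∀ {n} → Graph n → ℕ → Subset n → Set
IsTDS G k S = ∀ x → k ≤ ∣ N G x ∩ S ∣

IsMinimalTDS : ∀ {n} → Graph n → ℕ → Subset n → Set
IsMinimalTDS G k S = IsTDS G k S × (∀ T → T ⊂ S → ¬ IsTDS G k T)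

isTDS? : ∀ {n} (G : Graph n) k S → Dec (IsTDS G k S)
isTDS? G k S = all? λ x → k ≤? ∣ N G x ∩ S ∣

isMinimalTDS? : ∀ {n} (G : Graph n) k S → Dec (IsMinimalTDS G k S)
isMinimalTDS? G k S = isTDS? G k S ×-dec
  map′ (λ ∄T T T⊂S tds → ∄T (T , T⊂S , tds))
       (λ min (T , T⊂S , tds) → min T T⊂S tds)
       (¬? (anySubset? λ T → T ⊂? S ×-dec isTDS? G k T))

allSubsets : ∀ n → List (Subset n)
allSubsets zero    = Vec.[] ∷ []
allSubsets (suc n) = map (inside Vec.∷_) (allSubsets n) ++ map (outside Vec.∷_) (allSubsets n)

-- The upper k-tuple total domination number.  The default value 0 of `max` is
-- harmless when k ≤ δ G: then the whole vertex set is a kTDS, so a minimal one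
-- exists.
Γ : ∀ {n} → Graph n → ℕ → ℕ
Γ {n} G k = max 0 (map ∣_∣ (filter (isMinimalTDS? G k) (allSubsets n)))

-- The set of k-open private neighbors of v with respect to S.
opn : ∀ {n} → Graph n → ℕ → Fin n → Subset n → Pred (Fin n) 0ℓ
opn G k v S v′ = v ∈ N G v′ × ∣ N G v′ ∩ S ∣ ≡ k

-- The intersection of the sets F v over v ∈ S (everything when S is empty, which
-- a kTDS with k ≥ 1 of a nonempty graph is not).
⋂[_] : ∀ {n} → Subset n → (Fin n → Subset n) → Subset n
⋂[_] {n} S F = ⋂ (map F (filter (_∈? S) (allFin n)))

{-# OPTIONS --safe #-}
-- Remove L from S.  Each N x ∩ S loses at most ℓ vertices, so S ─ L is a
-- (k ∸ ℓ)TDS.  It is minimal: for v ∈ S ─ L, the private neighbour v′ has exactly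
-- k neighbours in S, and all of L is among them because L ⊆ S_v, so exactly k ∸ ℓ
-- remain, one of which is v.
module Submission where

open import Defs
open import Data.Fin using (Fin)
open import Data.Fin.Subset
  using (Subset; inside; outside; _∈_; _∉_; _⊆_; _⊂_; _∩_; _─_; ⋂; ∣_∣)
open import Data.Fin.Subset.Properties
  using (_∈?_; p⊆q⇒∣p∣≤∣q∣; p⊂q⇒∣p∣<∣q∣; x∈p∩q⁺; x∈p∩q⁻; p∩q⊆p; p∩q⊆q;
         ∣p∩q∣≤∣q∣; p─q⊆p; x∈p∧x∉q⇒x∈p─q)
open import Data.List using (List; _∷_)
open import Data.List.Extrema.Nat using (xs≤max)
open import Data.List.Membership.Propositional using () renaming (_∈_ to _∈ˡ_)
open import Data.List.Membership.Propositional.Properties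
  using (∈-map⁺; ∈-filter⁺; ∈-++⁺ˡ; ∈-++⁺ʳ; ∈-allFin)
import Data.List.Relation.Unary.All as All
open import Data.List.Relation.Unary.Any using (here; there)
open import Data.Nat using (ℕ; suc; _+_; _∸_; _≤_; _<_)
open import Data.Nat.Properties
open import Data.Product using (_,_; proj₁; proj₂)
import Data.Vec as Vec
import Relation.Unary as U
open import Relation.Binary.PropositionalEquality using (_≡_; refl; sym; trans; cong)
open import Relation.Nullary using (contradiction)

private
  variable
    n : ℕ

∈-─⇒∉ : ∀ (p q : Subset n) {x} → x ∈ p ─ q → x ∉ q
-- An `inside` at the head of `q` makes the head of `p ─ q` `outside`, so position zero cannot
-- belong to the difference.
∈-─⇒∉ (_ Vec.∷ _) (inside  Vec.∷ _) ()                Vec.here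
∈-─⇒∉ (_ Vec.∷ p) (_       Vec.∷ q) (Vec.there x∈p─q) (Vec.there x∈q) = ∈-─⇒∉ p q x∈p─q x∈q

∣p∣≡∣p─q∣+∣p∩q∣ : ∀ (p q : Subset n) → ∣ p ∣ ≡ ∣ p ─ q ∣ + ∣ p ∩ q ∣
∣p∣≡∣p─q∣+∣p∩q∣ Vec.[] Vec.[] = refl
∣p∣≡∣p─q∣+∣p∩q∣ (outside Vec.∷ p) (outside Vec.∷ q) = ∣p∣≡∣p─q∣+∣p∩q∣ p q
∣p∣≡∣p─q∣+∣p∩q∣ (outside Vec.∷ p) (inside  Vec.∷ q) = ∣p∣≡∣p─q∣+∣p∩q∣ p q
∣p∣≡∣p─q∣+∣p∩q∣ (inside  Vec.∷ p) (outside Vec.∷ q) = cong suc (∣p∣≡∣p─q∣+∣p∩q∣ p q)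
∣p∣≡∣p─q∣+∣p∩q∣ (inside  Vec.∷ p) (inside  Vec.∷ q) =
  trans (cong suc (∣p∣≡∣p─q∣+∣p∩q∣ p q)) (sym (+-suc ∣ p ─ q ∣ ∣ p ∩ q ∣))

∣p∣≤∣p─q∣+∣q∣ : ∀ (p q : Subset n) → ∣ p ∣ ≤ ∣ p ─ q ∣ + ∣ q ∣
∣p∣≤∣p─q∣+∣q∣ p q = ≤-trans (≤-reflexive (∣p∣≡∣p─q∣+∣p∩q∣ p q))
                            (+-monoʳ-≤ ∣ p ─ q ∣ (∣p∩q∣≤∣q∣ p q))

-- When `q ⊆ p`, all of `q` lies in `p ∩ q`, so splitting `p` along `q` takes away at least `∣ q ∣`
-- elements.
q⊆p⇒∣p─q∣≤∣p∣∸∣q∣ : ∀ (p q : Subset n) → q ⊆ p → ∣ p ─ q ∣ ≤ ∣ p ∣ ∸ ∣ q ∣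
q⊆p⇒∣p─q∣≤∣p∣∸∣q∣ p q q⊆p = m+n≤o⇒m≤o∸n ∣ p ─ q ∣ (begin
  ∣ p ─ q ∣ + ∣ q ∣      ≤⟨ +-monoʳ-≤ ∣ p ─ q ∣ (p⊆q⇒∣p∣≤∣q∣ (λ x∈q → x∈p∩q⁺ (q⊆p x∈q , x∈q))) ⟩
  ∣ p ─ q ∣ + ∣ p ∩ q ∣  ≡⟨ ∣p∣≡∣p─q∣+∣p∩q∣ p q ⟨
  ∣ p ∣                  ∎)
  where open ≤-Reasoning

p∩q─r⊆p∩[q─r] : ∀ (p q r : Subset n) → (p ∩ q) ─ r ⊆ p ∩ (q ─ r)
p∩q─r⊆p∩[q─r] p q r x∈ =
  let x∈p , x∈q = x∈p∩q⁻ p q (p─q⊆p (p ∩ q) r x∈)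
  in x∈p∩q⁺ (x∈p , x∈p∧x∉q⇒x∈p─q x∈q (∈-─⇒∉ (p ∩ q) r x∈))

⋂⊆ : ∀ {ps : List (Subset n)} {p} → p ∈ˡ ps → ⋂ ps ⊆ p
⋂⊆ {ps = p ∷ ps} (here refl) x∈ = p∩q⊆p p (⋂ ps) x∈
⋂⊆ {ps = p ∷ ps} (there p∈)  x∈ = ⋂⊆ p∈ (p∩q⊆q p (⋂ ps) x∈)

⋂[]⊆ : ∀ (S : Subset n) F {v} → v ∈ S → ⋂[ S ] F ⊆ F v
⋂[]⊆ S F {v} v∈S = ⋂⊆ (∈-map⁺ F (∈-filter⁺ (_∈? S) (∈-allFin v) v∈S))

∈-allSubsets : ∀ (S : Subset n) → S ∈ˡ allSubsets n
∈-allSubsets Vec.[]              = here refl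
∈-allSubsets (inside  Vec.∷ S)   = ∈-++⁺ˡ (∈-map⁺ _ (∈-allSubsets S))
∈-allSubsets (outside Vec.∷ S)   = ∈-++⁺ʳ _ (∈-map⁺ _ (∈-allSubsets S))

-- `Γ` is a maximum over a filtered list of all subsets, and a minimal TDS survives the filter, so
-- its size is among the values compared.
minimal⇒≤Γ : ∀ (G : Graph n) k {S} → IsMinimalTDS G k S → ∣ S ∣ ≤ Γ G k
minimal⇒≤Γ G k {S} min = All.lookup (xs≤max 0 _)
  (∈-map⁺ ∣_∣ (∈-filter⁺ (isMinimalTDS? G k) (∈-allSubsets S) min))

─-isTDS : ∀ (G : Graph n) k S L → IsTDS G k S → IsTDS G (k ∸ ∣ L ∣) (S ─ L)
─-isTDS G k S L tds x = m≤n+o⇒m∸n≤o k ∣ L ∣ (begin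
  k                              ≤⟨ tds x ⟩
  ∣ N G x ∩ S ∣                  ≤⟨ ∣p∣≤∣p─q∣+∣q∣ (N G x ∩ S) L ⟩
  ∣ (N G x ∩ S) ─ L ∣ + ∣ L ∣    ≤⟨ +-monoˡ-≤ ∣ L ∣ (p⊆q⇒∣p∣≤∣q∣ (p∩q─r⊆p∩[q─r] (N G x) S L)) ⟩
  ∣ N G x ∩ (S ─ L) ∣ + ∣ L ∣    ≡⟨ +-comm ∣ N G x ∩ (S ─ L) ∣ ∣ L ∣ ⟩
  ∣ L ∣ + ∣ N G x ∩ (S ─ L) ∣    ∎)
  where open ≤-Reasoning

-- Here `L` may be any common subset of the sets `N G (priv v) ∩ S`; their intersection is the
-- instance used for the theorem.
─-isMinimalTDS : ∀ (G : Graph n) k S L (priv : Fin n → Fin n) →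
  IsTDS G k S → (∀ v → v ∈ S → priv v U.∈ opn G k v S) →
  (∀ v → v ∈ S → L ⊆ N G (priv v) ∩ S) →
  IsMinimalTDS G (k ∸ ∣ L ∣) (S ─ L)
─-isMinimalTDS G k S L priv tds opn-priv L⊆ = ─-isTDS G k S L tds , minimal
  where
  open ≤-Reasoning
  minimal : ∀ T → T ⊂ S ─ L → IsTDS G (k ∸ ∣ L ∣) T → _
  -- The vertex `v` of `S ─ L` missed by `T` selects where `T` fails: `priv v` has fewer than
  -- `k ∸ ∣ L ∣` neighbours in `T`.
  minimal T (T⊆ , v , v∈S─L , v∉T) tdsT = contradiction (tdsT (priv v)) (<⇒≱ (begin-strict
    ∣ N′ ∩ T ∣              <⟨ p⊂q⇒∣p∣<∣q∣ N′∩T⊂ ⟩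
    -- An upper bound requires that removing `L` really costs `∣ L ∣` vertices, which is where
    -- `L ⊆ N′ ∩ S` enters.
    ∣ (N′ ∩ S) ─ L ∣        ≤⟨ q⊆p⇒∣p─q∣≤∣p∣∸∣q∣ (N′ ∩ S) L (L⊆ v v∈S) ⟩
    ∣ N′ ∩ S ∣ ∸ ∣ L ∣      ≡⟨ cong (_∸ ∣ L ∣) (proj₂ (opn-priv v v∈S)) ⟩
    k ∸ ∣ L ∣               ∎))
    where
    v∈S = p─q⊆p S L v∈S─L
    N′  = N G (priv v)

    ∈N′∩S─L : ∀ {x} → x ∈ N′ → x ∈ S ─ L → x ∈ (N′ ∩ S) ─ L
    ∈N′∩S─L x∈N′ x∈S─L =
      x∈p∧x∉q⇒x∈p─q (x∈p∩q⁺ (x∈N′ , p─q⊆p S L x∈S─L)) (∈-─⇒∉ S L x∈S─L)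

    N′∩T⊂ : N′ ∩ T ⊂ (N′ ∩ S) ─ L
    N′∩T⊂ = (λ x∈ → let x∈N′ , x∈T = x∈p∩q⁻ N′ T x∈ in ∈N′∩S─L x∈N′ (T⊆ x∈T))
          -- Strictness is witnessed by `v` itself: it is adjacent to `priv v` and lies in `S ─ L`,
          -- but not in `T`.
          , v , ∈N′∩S─L (proj₁ (opn-priv v v∈S)) v∈S─L
          , λ v∈ → v∉T (p∩q⊆q N′ T v∈)

mainTheorem7 : ∀ (m k : ℕ) (G : Graph (suc m)) → 1 ≤ k → k ≤ δ G →
    (S : Subset (suc m)) → IsMinimalTDS G k S → ∣ S ∣ ≡ Γ G k →
    (priv : Fin (suc m) → Fin (suc m)) →
    (∀ v → v ∈ S → priv v U.∈ opn G k v S) →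
    let L = ⋂[ S ] (λ v → N G (priv v) ∩ S)
        ℓ = ∣ L ∣
    in ℓ < k → Γ G k ≤ Γ G (k ∸ ℓ) + ℓ
mainTheorem7 m k G _ _ S (tds , _) ∣S∣≡Γ priv opn-priv _ = begin
  Γ G k                      ≡⟨ ∣S∣≡Γ ⟨
  ∣ S ∣                      ≤⟨ ∣p∣≤∣p─q∣+∣q∣ S L ⟩
  -- `S ─ L` competes in the maximum defining `Γ G (k ∸ ∣ L ∣)`, because the intersection `L` lies
  -- inside every `S[ v ]` with `v ∈ S`.
  ∣ S ─ L ∣ + ∣ L ∣          ≤⟨ +-monoˡ-≤ ∣ L ∣ (minimal⇒≤Γ G (k ∸ ∣ L ∣)
                                 (─-isMinimalTDS G k S L priv tds opn-priv (λ v → ⋂[]⊆ S S[_]))) ⟩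
  Γ G (k ∸ ∣ L ∣) + ∣ L ∣    ∎
  where
  open ≤-Reasoning
  S[_] : Fin (suc m) → Subset (suc m)
  S[ v ] = N G (priv v) ∩ S
  L = ⋂[ S ] S[_]
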